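{- Every finite non-trivial graph $G$ has a $T$-partition of width at most $18(\operatorname{tw}(G)+1)\Delta(G)$ for some tree $T$ with $\Delta(T)\leq 6\Delta(G)$.
   Context: For a graph $G$ and a tree $T$, a $T$-partition of $G$ is a partition $(V_x : x\in V(T))$ of $V(G)$ indexed by the nodes of $T$ (parts may be empty) such that for every edge $vw$ of $G$, if $v\in V_x$ and $w\in V_y$ then $x=y$ or $xy\in E(T)$. Its width is $\max\{|V_x| : x\in V(T)\}$. A graph is non-trivial if it has at least one edge. $\operatorname{tw}(G)$ denotes the treewidth of $G$ and $\Delta(G)$ the maximum degree of $G$. -}

module Defs where

open import Data.Nat using (ℕ; zero; suc; _+_; _*_; _∸_; _≤_; _⊔_)
open import Data.Fin using (Fin; zero; suc)
open import Data.Bool using (Bool; true; false; if_then_else_)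
open import Data.List using (List; []; _∷_; _++_; [_]; length)
open import Data.List.Relation.Unary.Unique.Propositional using (Unique)
open import Data.Product using (Σ; _×_; _,_; ∃)
open import Data.Sum using (_⊎_)
open import Data.Unit using (⊤)
open import Relation.Binary.PropositionalEquality using (_≡_)

record Graph (n : ℕ) : Set where
  field
    adj    : Fin n → Fin n → Bool
    sym    : ∀ x y → adj x y ≡ adj y x
    irrefl : ∀ x → adj x x ≡ false
open Graph public

countTrue : (n : ℕ) → (Fin n → Bool) → ℕ
countTrue zero    f = 0
countTrue (suc n) f = (if f zero then 1 else 0) + countTrue n (λ i → f (suc i))

maxOver : (n : ℕ) → (Fin n → ℕ) → ℕ
maxOver zero    f = 0
maxOver (suc n) f = f zero ⊔ maxOver n (λ i → f (suc i))

degree : ∀ {n} → Graph n → Fin n → ℕ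
degree {n} G v = countTrue n (adj G v)

-- Δ(G), the maximum degree (0 for the empty graph)
maxDegree : ∀ {n} → Graph n → ℕ
maxDegree {n} G = maxOver n (degree G)

NonTrivial : ∀ {n} → Graph n → Set
NonTrivial G = Σ _ λ x → Σ _ λ y → adj G x y ≡ true

data WalkWithin {n} (G : Graph n) (P : Fin n → Set) : Fin n → Fin n → Set where
  here : ∀ {x} → P x → WalkWithin G P x x
  step : ∀ {x y z} → P x → adj G x y ≡ true → WalkWithin G P y z → WalkWithin G P x z

Connected : ∀ {n} → Graph n → Set
Connected G = ∀ x y → WalkWithin G (λ _ → ⊤) x y

IsPathList : ∀ {n} → Graph n → List (Fin n) → Set
IsPathList G []           = ⊤
IsPathList G (x ∷ [])     = ⊤
IsPathList G (x ∷ y ∷ xs) = (adj G x y ≡ true) × IsPathList G (y ∷ xs)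

record Cycle {n} (G : Graph n) : Set where
  field
    start  : Fin n
    rest   : List (Fin n)
    long   : 2 ≤ length rest
    uniq   : Unique (start ∷ rest)
    closed : IsPathList G (start ∷ rest ++ [ start ])

Acyclic : ∀ {n} → Graph n → Set
Acyclic G = Cycle G → Data.Empty.⊥
  where import Data.Empty

IsTree : ∀ {n} → Graph n → Set
IsTree {n} G = (1 ≤ n) × Connected G × Acyclic G

record TreeDecomposition {n} (G : Graph n) : Set where
  field
    m       : ℕ
    T       : Graph m
    isTree  : IsTree T
    bag     : Fin m → Fin n → Bool
    covV    : ∀ v → Σ (Fin m) λ x → bag x v ≡ true
    covE    : ∀ v w → adj G v w ≡ true → Σ (Fin m) λ x → (bag x v ≡ true) × (bag x w ≡ true)
    subtree : ∀ v x y → bag x v ≡ true → bag y v ≡ true →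
              WalkWithin T (λ z → bag z v ≡ true) x y

tdWidth : ∀ {n} {G : Graph n} → TreeDecomposition G → ℕ
tdWidth {n} D = maxOver m (λ x → countTrue n (bag x)) ∸ 1
  where open TreeDecomposition D

IsTreewidth : ∀ {n} → Graph n → ℕ → Set
IsTreewidth G k = (Σ (TreeDecomposition G) λ D → tdWidth D ≡ k)
                × (∀ (D : TreeDecomposition G) → k ≤ tdWidth D)

-- T-partitions.  A partition (V_x : x ∈ V(T)) of V(G), parts possibly
-- empty, is given by the map f sending each vertex to the index of its part.

IsTPartition : ∀ {n m} → Graph n → Graph m → (Fin n → Fin m) → Set
IsTPartition G T f = ∀ v w → adj G v w ≡ true → (f v ≡ f w) ⊎ (adj T (f v) (f w) ≡ true)

partSize : ∀ {n m} → (Fin n → Fin m) → Fin m → ℕ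
partSize {n} f x = countTrue n (λ v → isYes (f v Data.Fin.≟ x))
  where open import Relation.Nullary.Decidable using (isYes)
        import Data.Fin

partitionWidth : ∀ {n m} → (Fin n → Fin m) → ℕ
partitionWidth {n} {m} f = maxOver m (partSize f)

{-# OPTIONS --safe #-}
module Submission where

-- Write K = tw(G) + 1 and Δ for the maximum degree. Every S ⊆ W with 4K ≤ |S| ≤ 12KΔ lies in the root
-- part of a rooted tree-partition of G[W] in which the root part has size at most (3|S| − 4K)/2
-- and the root has at most |S|/2K − 1 children; this is shown by induction on |W|.
--   If W − S is small, it becomes a single child.
--   If |S| ≤ 12K, recurse on W − S with (a superset of) the neighbours of S, and make S the new root.
--   If |S| > 12K, some bag X separates W into two sides, each with enough of S; recurse on both
--   with X added to S, and identify the two roots, whose parts both contain X.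

open import Defs
open import Data.Nat using (ℕ; _+_; _*_; _≤_)
open import Data.Fin using (Fin)
open import Data.Product using (Σ; _×_)

open import Data.Bool using (Bool; true; false; _∧_; _∨_; not; if_then_else_)
open import Data.Bool.Properties using (∧-conicalˡ; ∧-conicalʳ; ∨-zeroʳ; ∨-comm; ¬-not; not-¬)
open import Data.Empty using (⊥-elim)
open import Data.Fin using (zero; suc; toℕ; _↑ˡ_; _↑ʳ_; splitAt; fromℕ<; _≟_)
open import Data.Fin.Properties
  using (suc-injective; ↑ˡ-injective; ↑ʳ-injective; toℕ-↑ˡ; toℕ-↑ʳ
        ; splitAt-↑ˡ; splitAt-↑ʳ; splitAt⁻¹-↑ˡ; splitAt⁻¹-↑ʳ)
open import Data.List using (List; []; _∷_; map; _++_; [_]; allFin)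
open import Data.List.Membership.DecPropositional using () renaming (_∈?_ to member?)
open import Data.List.Membership.Propositional using (_∈_; _∉_)
open import Data.List.Membership.Propositional.Properties using (∈-allFin)
open import Data.List.Relation.Unary.All as All using (All; []; _∷_)
open import Data.List.Relation.Unary.All.Properties using (¬Any⇒All¬)
open import Data.List.Relation.Unary.Any using (here; there)
open import Data.List.Relation.Unary.Unique.Propositional using (Unique; []; _∷_)
open import Data.Nat using (zero; suc; _<_; _⊔_; z≤n; s≤s; _≤?_; _<?_)
open import Data.Nat.ListAction using (sum)
open import Data.Nat.Properties as ℕₚ using (≤-refl; ≤-trans; ≤-reflexive; +-mono-≤; *-monoʳ-≤)
open import Data.Nat.Tactic.RingSolver using (solve-∀)
open import Data.Product using (∃; _,_; proj₁; proj₂)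
open import Data.Sum using (_⊎_; inj₁; inj₂; [_,_]′)
open import Data.Unit using (⊤)
open import Relation.Binary.Construct.Closure.ReflexiveTransitive as Star using (Star; ε; _◅_; _◅◅_)
open import Relation.Binary.PropositionalEquality
  using (_≡_; _≢_; refl; trans; cong; subst) renaming (sym to ≡-sym)
open import Relation.Nullary using (¬_; Dec; yes; no)
open import Relation.Nullary.Decidable using (isYes)

-- Passing from S to its neighbours multiplies the size of the root set by Δ, so it is affordable
-- only for small S; splitting along a bag brings larger sets down first. The threshold is 12K = 4K
-- + 8K: one side of a separation takes between 4K and 8K vertices of S, so the other keeps at least
-- 4K, and both satisfy the lower bound. The neighbours of at most 12K vertices number at most 12KΔ,
-- the upper bound.
--
-- The subtracted terms in the root bounds pay for gluing. Let x ≤ K count the vertices of X in W.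
-- The two root sets have total size at most |S| + 2x, and the two root parts share these x
-- vertices. So the glued root part has size at most (3(|S| + 2x) - 8K)/2 - x = (3|S| + 4x - 8K)/2 ≤
-- (3|S| - 4K)/2, and its node has at most (|S| + 2x)/2K - 2 ≤ |S|/2K - 1 children. The lower bound
-- 4K ≤ |S| is exactly what a root part S with a single child needs. At |S| = 12KΔ the bounds read
-- 18KΔ - 2K and 6Δ - 1: the width, and a degree with room for a parent.

private
  Subset : ℕ → Set
  Subset n = Fin n → Bool

-- Boolean connectives and linear inequalities

isYes⁺ : ∀ {P : Set} (P? : Dec P) → P → isYes P? ≡ true
isYes⁺ (yes _) p = refl
isYes⁺ (no ¬p) p = ⊥-elim (¬p p)

isYes⁻ : ∀ {P : Set} (P? : Dec P) → isYes P? ≡ true → P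
isYes⁻ (yes p) _ = p

∧⁺ : ∀ {a b} → a ≡ true → b ≡ true → a ∧ b ≡ true
∧⁺ refl refl = refl

∨⁺ˡ : ∀ {a b} → a ≡ true → a ∨ b ≡ true
∨⁺ˡ refl = refl

∨⁺ʳ : ∀ {a b} → b ≡ true → a ∨ b ≡ true
∨⁺ʳ {a} refl = ∨-zeroʳ a

∨⁻ : ∀ {a b} → a ∨ b ≡ true → a ≡ true ⊎ b ≡ true
∨⁻ {true}  _ = inj₁ refl
∨⁻ {false} e = inj₂ e

absurd : ∀ {A : Set} {b} → b ≡ true → b ≡ false → A
absurd refl ()

dichotomy : ∀ b → b ≡ true ⊎ b ≡ false
dichotomy true  = inj₁ refl
dichotomy false = inj₂ refl

-- A certificate for linear inequalities without subtraction: the hypotheses are added up to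
-- `a ≤ b`, and the equation says that `r - l` is `b - a` plus the slack `s`, which leaves a ring
-- identity to check.
linear : ∀ {a b l r} s → a ≤ b → l + b + s ≡ r + a → l ≤ r
linear {a} {b} {l} {r} s a≤b e = ℕₚ.+-cancelʳ-≤ b l r
  (≤-trans (ℕₚ.m≤m+n (l + b) s) (≤-trans (≤-reflexive e) (ℕₚ.+-monoʳ-≤ r a≤b)))

-- Cardinalities of finite subsets

⟦_⟧ : Bool → ℕ
⟦ b ⟧ = if b then 1 else 0

private
  pointwise : ∀ {n} → List (Subset n) → Fin n → ℕ
  pointwise ps v = sum (map (λ p → ⟦ p v ⟧) ps)

  total : ∀ {n} → List (Subset n) → ℕ
  total {n} ps = sum (map (countTrue n) ps)

  tails : ∀ {n} → List (Subset (suc n)) → List (Subset n)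
  tails = map (λ p i → p (suc i))

  total-suc : ∀ {n} (ps : List (Subset (suc n))) →
              total ps ≡ pointwise ps zero + total (tails ps)
  total-suc []       = refl
  total-suc (p ∷ ps) rewrite total-suc ps = swap ⟦ p zero ⟧ _ _ _
    where
    swap : ∀ a b c d → a + b + (c + d) ≡ a + c + (b + d)
    swap = solve-∀

  pointwise-tails : ∀ {n} (ps : List (Subset (suc n))) i → pointwise (tails ps) i ≡ pointwise ps (suc i)
  pointwise-tails []       i = refl
  pointwise-tails (p ∷ ps) i = cong (⟦ p (suc i) ⟧ +_) (pointwise-tails ps i)

-- Counting vertex by vertex reduces an inequality between sums of cardinalities to a Boolean case
-- check at a single vertex.
total-mono : ∀ {n} (ps qs : List (Subset n)) → (∀ v → pointwise ps v ≤ pointwise qs v) → total ps ≤ total qs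
total-mono {zero} ps qs h = ≤-trans (≤-reflexive (empty ps)) z≤n
  where
  empty : ∀ (ps : List (Subset 0)) → total ps ≡ 0
  empty []       = refl
  empty (p ∷ ps) = empty ps
total-mono {suc n} ps qs h rewrite total-suc ps | total-suc qs =
  +-mono-≤ (h zero) (total-mono (tails ps) (tails qs) λ i →
    subst (_≤ pointwise (tails qs) i) (≡-sym (pointwise-tails ps i))
      (subst (pointwise ps (suc i) ≤_) (≡-sym (pointwise-tails qs i)) (h (suc i))))

count-mono : ∀ {n} {p q : Subset n} → (∀ v → p v ≡ true → q v ≡ true) → countTrue n p ≤ countTrue n q
count-mono {zero}  h = z≤n
count-mono {suc n} {p} {q} h = +-mono-≤ (bit (h zero)) (count-mono (λ v → h (suc v)))
  where
  bit : ∀ {a b} → (a ≡ true → b ≡ true) → ⟦ a ⟧ ≤ ⟦ b ⟧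
  bit {false} h = z≤n
  bit {true}  h rewrite h refl = ≤-refl

count-∨ : ∀ {n} (p q : Subset n) →
          countTrue n (λ v → p v ∨ q v) ≤ countTrue n p + countTrue n q
count-∨ {n} p q = linear 0
  (total-mono ((λ v → p v ∨ q v) ∷ []) (p ∷ q ∷ []) λ v → bits (p v) (q v))
  (unit (countTrue n λ v → p v ∨ q v) (countTrue n p) (countTrue n q))
  where
  bits : ∀ a b → ⟦ a ∨ b ⟧ + 0 ≤ ⟦ a ⟧ + (⟦ b ⟧ + 0)
  bits true  b = s≤s z≤n
  bits false b = ≤-refl
  unit : ∀ a b c → a + (b + (c + 0)) + 0 ≡ b + c + (a + 0)
  unit = solve-∀

count-false : ∀ {n} (p : Subset n) → (∀ v → p v ≡ false) → countTrue n p ≡ 0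
count-false {zero}  p h = refl
count-false {suc n} p h rewrite h zero = count-false (λ v → p (suc v)) (λ v → h (suc v))

count-true : ∀ {n} → n ≤ countTrue n (λ _ → true)
count-true {zero}  = z≤n
count-true {suc n} = s≤s count-true

count-≤-size : ∀ {n} (p : Subset n) → countTrue n p ≤ n
count-≤-size {zero}  p = z≤n
count-≤-size {suc n} p with p zero
... | true  = s≤s (count-≤-size _)
... | false = ℕₚ.m≤n⇒m≤1+n (count-≤-size _)

count-unique : ∀ {n} (p : Subset n) → (∀ v w → p v ≡ true → p w ≡ true → v ≡ w) → countTrue n p ≤ 1
count-unique {zero}  p h = z≤n
count-unique {suc n} p h with p zero in e
... | true  = s≤s (≤-reflexive (count-false _ λ v → ¬-not λ t → 0≢suc (h zero (suc v) e t)))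
  where
  0≢suc : ∀ {i : Fin n} → zero ≢ suc i
  0≢suc ()
... | false = count-unique _ λ v w pv pw → suc-injective (h (suc v) (suc w) pv pw)

count-++ : ∀ m {n} (p : Subset (m + n)) →
           countTrue (m + n) p ≡ countTrue m (λ i → p (i ↑ˡ n)) + countTrue n (λ j → p (m ↑ʳ j))
count-++ zero    p = refl
count-++ (suc m) p rewrite count-++ m (λ i → p (suc i)) = ≡-sym (ℕₚ.+-assoc ⟦ p zero ⟧ _ _)

subset-of-size : ∀ {n} (p q : Subset n) c → (∀ v → p v ≡ true → q v ≡ true) →
  countTrue n p ≤ c → c ≤ countTrue n q →
  Σ (Subset n) λ r → (∀ v → p v ≡ true → r v ≡ true) × (∀ v → r v ≡ true → q v ≡ true) × countTrue n r ≡ c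
subset-of-size {zero} p q .0 p⊆q p≤c z≤n = p , (λ ()) , (λ ()) , refl
subset-of-size {suc n} p q c p⊆q p≤c c≤q with p zero in ep | q zero in eq
... | true | false = absurd (p⊆q zero ep) eq
... | false | false
    with r , p⊆r , r⊆q , e ← subset-of-size _ _ c (λ v → p⊆q (suc v)) p≤c c≤q
    = (λ { zero → false ; (suc v) → r v })
    , (λ { zero t → absurd t ep ; (suc v) t → p⊆r v t })
    , (λ { (suc v) t → r⊆q v t }) , e
... | true | true with c | p≤c | c≤q
...   | suc c | s≤s p≤c | s≤s c≤q
    with r , p⊆r , r⊆q , e ← subset-of-size _ _ c (λ v → p⊆q (suc v)) p≤c c≤q
    = (λ { zero → true ; (suc v) → r v })
    , (λ { zero t → refl ; (suc v) t → p⊆r v t })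
    , (λ { zero t → eq ; (suc v) t → r⊆q v t }) , cong suc e
subset-of-size {suc n} p q c p⊆q p≤c c≤q | false | true with c ≤? countTrue n (λ i → q (suc i))
-- Without `zero`, `q` has fewer than `c` elements, and with it at least `c`; so `q` itself has
-- exactly `c`.
... | no c≰ = q , p⊆q , (λ v t → t)
    , trans (cong (λ b → ⟦ b ⟧ + countTrue n (λ i → q (suc i))) eq) (ℕₚ.≤-antisym (ℕₚ.≰⇒> c≰) c≤q)
... | yes c≤ with r , p⊆r , r⊆q , e ← subset-of-size _ _ c (λ v → p⊆q (suc v)) p≤c c≤
    = (λ { zero → false ; (suc v) → r v })
    , (λ { zero t → absurd t ep ; (suc v) t → p⊆r v t })
    , (λ { (suc v) t → r⊆q v t }) , e

private
  some : (m : ℕ) → (Fin m → Bool) → Bool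
  some zero    p = false
  some (suc m) p = p zero ∨ some m (λ i → p (suc i))

some⁺ : ∀ {m} (p : Fin m → Bool) i → p i ≡ true → some m p ≡ true
some⁺ p zero    t = ∨⁺ˡ t
some⁺ p (suc i) t = ∨⁺ʳ {p zero} (some⁺ (λ j → p (suc j)) i t)

-- The union bound. With adjacency rows for `a` it bounds the neighbourhood of a set by its size
-- times the maximum degree.
count-some : ∀ {m n} (p : Subset m) (a : Fin m → Subset n) d → (∀ i → countTrue n (a i) ≤ d) →
  countTrue n (λ v → some m (λ i → p i ∧ a i v)) ≤ countTrue m p * d
count-some {zero}  {n} p a d h = ≤-reflexive (count-false {n} _ λ _ → refl)
count-some {suc m} {n} p a d h = ≤-trans (count-∨ (λ v → p zero ∧ a zero v) _)
  (≤-trans (+-mono-≤ (first (p zero)) (count-some (λ i → p (suc i)) (λ i → a (suc i)) d λ i → h (suc i)))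
    (≤-reflexive (≡-sym (ℕₚ.*-distribʳ-+ d ⟦ p zero ⟧ _))))
  where
  first : ∀ b → countTrue n (λ v → b ∧ a zero v) ≤ ⟦ b ⟧ * d
  first true  = ≤-trans (h zero) (ℕₚ.m≤m+n d 0)
  first false = ≤-reflexive (count-false {n} _ λ _ → refl)

maxOver-ub : ∀ {n} (f : Fin n → ℕ) i → f i ≤ maxOver n f
maxOver-ub f zero    = ℕₚ.m≤m⊔n _ _
maxOver-ub f (suc i) = ≤-trans (maxOver-ub (λ j → f (suc j)) i) (ℕₚ.m≤n⊔m _ _)

maxOver-lub : ∀ {n} (f : Fin n → ℕ) {c} → (∀ i → f i ≤ c) → maxOver n f ≤ c
maxOver-lub {zero}  f h = z≤n
maxOver-lub {suc n} f h = ℕₚ.⊔-lub (h zero) (maxOver-lub (λ i → f (suc i)) λ i → h (suc i))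

-- Bridges and leaf orders in trees

data Path {A : Set} (R : A → A → Set) : A → List A → A → Set where
  []  : ∀ {x} → Path R x [] x
  _∷_ : ∀ {x y z p} → R x y → Path R y p z → Path R x (y ∷ p) z

module _ {m} {R : Fin m → Fin m → Set} where

  path-from : ∀ {x y z p} → Path R y p z → Unique (y ∷ p) → x ∈ y ∷ p →
              Σ (List (Fin m)) λ p′ → Path R x p′ z × Unique (x ∷ p′)
  path-from π       u       (here refl) = _ , π , u
  path-from (r ∷ π) (_ ∷ u) (there x∈)  = path-from π u x∈

  -- Loop erasure: if the new start already occurs on the simple path, the path is cut back to that
  -- occurrence.
  simple-path : ∀ {x z} → Star R x z → Σ (List (Fin m)) λ p → Path R x p z × Unique (x ∷ p)
  simple-path ε = [] , [] , [] ∷ []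
  simple-path {x} (_◅_ {j = y} r s) with p , π , u ← simple-path s with member? _≟_ x (y ∷ p)
  ... | yes x∈ = path-from π u x∈
  ... | no x∉  = y ∷ p , r ∷ π , ¬Any⇒All¬ _ x∉ ∷ u

module _ {m} (T : Graph m) where

  EdgeExcept : Fin m → Fin m → Fin m → Fin m → Set
  EdgeExcept w u a b = adj T a b ≡ true × ¬ (a ≡ w × b ≡ u)

  -- A simple path of two or more steps closes to a cycle through the edge, and a single step would
  -- be the deleted edge. So deleting one direction of the edge is enough.
  acyclic⇒bridge : Acyclic T → ∀ {w u} → adj T w u ≡ true → ¬ Star (EdgeExcept w u) w u
  acyclic⇒bridge acyclic {w} {u} wu s with simple-path s
  ... | [] , [] , _ = absurd wu (irrefl T _)
  ... | _ ∷ [] , r ∷ [] , _ = proj₂ r (refl , refl)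
  ... | y ∷ z ∷ p , π , uniq = acyclic record
    { start = w ; rest = y ∷ z ∷ p ; long = s≤s (s≤s z≤n) ; uniq = uniq
    ; closed = close π }
    where
    close : ∀ {x q} → Path (EdgeExcept w u) x q u → IsPathList T (x ∷ q ++ [ w ])
    close []      = trans (Graph.sym T _ _) wu , _
    close (r ∷ π) = proj₁ r , close π

  -- An elimination order: in a tree, the head is a leaf of the subtree spanned by the list, and
  -- removing it leaves a connected rest.
  data Grown : List (Fin m) → Set where
    root : ∀ r → Grown (r ∷ [])
    grow : ∀ {us} u w → Grown us → u ∈ us → w ∉ us → adj T u w ≡ true → Grown (w ∷ us)

  EdgeIn : List (Fin m) → Fin m → Fin m → Set
  EdgeIn us a b = adj T a b ≡ true × a ∈ us × b ∈ us

  grown-connected : ∀ {us} → Grown us → ∀ {x y} → x ∈ us → y ∈ us → Star (EdgeIn us) x y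
  grown-connected (root r) (here refl) (here refl) = ε
  grown-connected (grow {us} u w g u∈ w∉ uw) = go
    where
    widen : ∀ {a b} → EdgeIn us a b → EdgeIn (w ∷ us) a b
    widen (e , a∈ , b∈) = e , there a∈ , there b∈
    go : ∀ {x y} → x ∈ w ∷ us → y ∈ w ∷ us → Star (EdgeIn (w ∷ us)) x y
    go (here refl) (here refl) = ε
    go (here refl) (there y∈)  =
      (trans (Graph.sym T _ _) uw , here refl , there u∈) ◅ Star.map widen (grown-connected g u∈ y∈)
    go (there x∈)  (here refl) =
      Star.map widen (grown-connected g x∈ u∈) ◅◅ ((uw , there u∈ , here refl) ◅ ε)
    go (there x∈)  (there y∈)  = Star.map widen (grown-connected g x∈ y∈)

  grow-along : ∀ {P us a x} → Grown us → a ∈ us → WalkWithin T P a x →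
               Σ (List (Fin m)) λ us′ → Grown us′ × (∀ {y} → y ∈ us → y ∈ us′) × x ∈ us′
  grow-along g a∈ (here _) = _ , g , (λ y∈ → y∈) , a∈
  grow-along {us = us} g a∈ (step {y = y} _ e s) with member? _≟_ y us
  ... | yes y∈ = grow-along g y∈ s
  ... | no y∉ with us′ , g′ , us⊆ , x∈ ← grow-along (grow _ y g a∈ y∉ e) (here refl) s
      = us′ , g′ , (λ z∈ → us⊆ (there z∈)) , x∈

  spanning : Connected T → Fin m → Σ (List (Fin m)) λ us → Grown us × (∀ x → x ∈ us)
  spanning connected r with reach (allFin m)
    where
    reach : ∀ xs → Σ (List (Fin m)) λ us → Grown us × r ∈ us × (∀ {x} → x ∈ xs → x ∈ us)
    reach [] = r ∷ [] , root r , here refl , λ ()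
    reach (x ∷ xs) with us , g , r∈ , h ← reach xs
                   with us′ , g′ , us⊆ , x∈ ← grow-along g r∈ (connected r x)
      = us′ , g′ , us⊆ r∈ , λ { (here refl) → x∈ ; (there y∈) → us⊆ (h y∈) }
  ... | us , g , _ , h = us , g , λ x → h (∈-allFin x)

-- The two sides are H and (V − H) ∪ X, and they meet in X.
record Separation {n} (G : Graph n) (K : ℕ) (S : Subset n) : Set where
  field
    X H    : Subset n
    X⊆H    : ∀ v → X v ≡ true → H v ≡ true
    leave  : ∀ v w → adj G v w ≡ true → H v ≡ true → H w ≡ false → X v ≡ true
    X-size : countTrue n X ≤ K
    H-low  : 4 * K ≤ countTrue n (λ v → S v ∧ H v)
    H-high : countTrue n (λ v → S v ∧ H v) ≤ 8 * K

module _ {n} {G : Graph n} (D : TreeDecomposition G) (K : ℕ)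
  (bag-size : ∀ x → countTrue n (TreeDecomposition.bag D x) ≤ suc K)
  (S : Subset n) where
  open TreeDecomposition D

  -- If `v` were not in the bag of `u`, the walk from `w` to `y` through bags containing `v` would
  -- miss `u`, and from `y` one reaches `u` inside `us`, away from `w`. Together they join `w` to
  -- `u` without the edge between them, which is a bridge.
  bag-parent : ∀ {us u w v y} → Grown T us → u ∈ us → w ∉ us → adj T u w ≡ true → y ∈ us →
               bag w v ≡ true → bag y v ≡ true → bag u v ≡ true
  bag-parent {us} {u} {w} {v} {y} g u∈ w∉ uw y∈ bw by with dichotomy (bag u v)
  ... | inj₁ bu = bu
  ... | inj₂ ¬bu = ⊥-elim (acyclic⇒bridge T (proj₂ (proj₂ isTree)) (trans (Graph.sym T w u) uw)
          (avoid (subtree v w y bw by) ◅◅ Star.map inside (grown-connected T g y∈ u∈)))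
    where
    head∈bag : ∀ {x z} → WalkWithin T (λ a → bag a v ≡ true) x z → bag x v ≡ true
    head∈bag (here b)     = b
    head∈bag (step b _ _) = b
    avoid : ∀ {x z} → WalkWithin T (λ a → bag a v ≡ true) x z → Star (EdgeExcept T w u) x z
    avoid (here _)     = ε
    avoid (step _ e s) = (e , λ { (_ , refl) → absurd (head∈bag s) ¬bu }) ◅ avoid s
    inside : ∀ {a b} → EdgeIn T us a b → EdgeExcept T w u a b
    inside (e , a∈ , _) = e , λ { (refl , _) → w∉ a∈ }

  -- h x is the union of the bags of x and of the nodes already contracted into x. The latest node w
  -- is contracted into its parent u until some hull meets S in at least 4(K + 1) vertices;
  -- as a union of two hulls below that threshold it meets S in at most 8(K + 1).
  separate : ∀ {us} → Grown T us → (h : Fin m → Subset n) →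
    (∀ x v → bag x v ≡ true → h x v ≡ true) →
    (∀ {x y} v → x ∈ us → y ∈ us → h x v ≡ true → h y v ≡ true → x ≢ y → bag x v ≡ true) →
    (∀ v → Σ (Fin m) λ x → x ∈ us × h x v ≡ true) →
    (∀ v w → adj G v w ≡ true → Σ (Fin m) λ x → x ∈ us × h x v ≡ true × h x w ≡ true) →
    (∀ {x} → x ∈ us → countTrue n (λ v → S v ∧ h x v) < 4 * suc K) →
    4 * suc K ≤ countTrue n S → Separation G (suc K) S
  separate (root r) h bag⊆h disjoint coverV coverE small large =
    -- A single remaining hull contains every vertex, hence all of `S`, and so cannot be below the
    -- threshold.
    ⊥-elim (ℕₚ.<⇒≱ (small (here refl)) (≤-trans large (count-mono λ v Sv → ∧⁺ Sv (in-root v))))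
    where
    in-root : ∀ v → h r v ≡ true
    in-root v with _ , here refl , hv ← coverV v = hv
  separate {w ∷ us} (grow u w g u∈ w∉ uw) h bag⊆h disjoint coverV coverE small large = result
    where
    h′ : Fin m → Subset n
    h′ x v = h x v ∨ (isYes (x ≟ u) ∧ h w v)

    h′-elim : ∀ x v → h′ x v ≡ true → h x v ≡ true ⊎ (x ≡ u × h w v ≡ true)
    h′-elim x v t with ∨⁻ {h x v} t
    ... | inj₁ hx = inj₁ hx
    ... | inj₂ hw = inj₂ (isYes⁻ (x ≟ u) (∧-conicalˡ _ _ hw) , ∧-conicalʳ (isYes (x ≟ u)) _ hw)

    fromW : ∀ v → h w v ≡ true → h′ u v ≡ true
    fromW v hw = ∨⁺ʳ {h u v} (∧⁺ (isYes⁺ (u ≟ u) refl) hw)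

    ≢w : ∀ {x} → x ∈ us → x ≢ w
    ≢w x∈ refl = w∉ x∈

    disjoint′ : ∀ {x y} v → x ∈ us → y ∈ us → h′ x v ≡ true → h′ y v ≡ true → x ≢ y → bag x v ≡ true
    disjoint′ {x} {y} v x∈ y∈ hx hy x≢y with h′-elim x v hx | h′-elim y v hy
    ... | inj₁ a | inj₁ b = disjoint v (there x∈) (there y∈) a b x≢y
    ... | inj₁ a | inj₂ (refl , b) = disjoint v (there x∈) (here refl) a b (≢w x∈)
    -- Here `v` comes to `u` from the hull of `w`. The invariant, applied in both orders, puts it
    -- into the bags of `w` and `y`, and `bag-parent` carries it to the bag of `u`.
    ... | inj₂ (refl , a) | inj₁ b =
      bag-parent g u∈ w∉ uw y∈ (disjoint v (here refl) (there y∈) a b (λ e → ≢w y∈ (≡-sym e)))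
                               (disjoint v (there y∈) (here refl) b a (≢w y∈))
    ... | inj₂ (refl , _) | inj₂ (refl , _) = ⊥-elim (x≢y refl)

    coverV′ : ∀ v → Σ (Fin m) λ x → x ∈ us × h′ x v ≡ true
    coverV′ v with coverV v
    ... | _ , here refl , t = u , u∈ , fromW v t
    ... | x , there x∈ , t  = x , x∈ , ∨⁺ˡ t

    coverE′ : ∀ v w → adj G v w ≡ true → Σ (Fin m) λ x → x ∈ us × h′ x v ≡ true × h′ x w ≡ true
    coverE′ v w e with coverE v w e
    ... | _ , here refl , a , b = u , u∈ , fromW v a , fromW w b
    ... | x , there x∈ , a , b  = x , x∈ , ∨⁺ˡ a , ∨⁺ˡ b

    leave : ∀ v w → adj G v w ≡ true → h′ u v ≡ true → h′ u w ≡ false → bag u v ≡ true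
    leave v w e hv ¬hw with coverE′ v w e
    ... | x , x∈ , a , b with u ≟ x
    ...   | yes refl = absurd b ¬hw
    -- The edge is covered by a hull other than that of `u`, so `v` is shared by two hulls, and
    -- hulls meet only in bags.
    ...   | no u≢x   = disjoint′ v u∈ x∈ hv a u≢x

    at-most : countTrue n (λ v → S v ∧ h′ u v) ≤ 8 * suc K
    at-most = ≤-trans (count-mono split) (≤-trans (count-∨ (λ v → S v ∧ h u v) (λ v → S v ∧ h w v))
      (≤-trans (+-mono-≤ (ℕₚ.<⇒≤ (small (there u∈))) (ℕₚ.<⇒≤ (small (here refl))))
        (≤-reflexive (≡-sym (ℕₚ.*-distribʳ-+ (suc K) 4 4)))))
      where
      split : ∀ v → S v ∧ h′ u v ≡ true → (S v ∧ h u v) ∨ (S v ∧ h w v) ≡ true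
      split v t with h′-elim u v (∧-conicalʳ (S v) _ t)
      ... | inj₁ a       = ∨⁺ˡ (∧⁺ (∧-conicalˡ (S v) _ t) a)
      ... | inj₂ (_ , b) = ∨⁺ʳ {S v ∧ h u v} (∧⁺ (∧-conicalˡ (S v) _ t) b)

    result : Separation G (suc K) S
    result with countTrue n (λ v → S v ∧ h′ u v) <? 4 * suc K
    ... | no  ≮ = record
      { X = bag u ; H = h′ u ; X⊆H = λ v b → ∨⁺ˡ (bag⊆h u v b) ; leave = leave
      ; X-size = bag-size u ; H-low = ℕₚ.≮⇒≥ ≮ ; H-high = at-most }
    ... | yes small-u = separate g h′ (λ x v b → ∨⁺ˡ (bag⊆h x v b)) disjoint′ coverV′ coverE′
                        (λ {x} → small′ (x ≟ u)) large
      where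
      small′ : ∀ {x} → Dec (x ≡ u) → x ∈ us → countTrue n (λ v → S v ∧ h′ x v) < 4 * suc K
      small′ (yes refl) _ = small-u
      small′ {x} (no x≢u) x∈ = ℕₚ.≤-<-trans (count-mono drop) (small (there x∈))
        where
        drop : ∀ v → S v ∧ h′ x v ≡ true → S v ∧ h x v ≡ true
        drop v t with h′-elim x v (∧-conicalʳ (S v) _ t)
        ... | inj₁ a       = ∧⁺ (∧-conicalˡ (S v) _ t) a
        ... | inj₂ (e , _) = ⊥-elim (x≢u e)

  balanced-separation : 4 * suc K ≤ countTrue n S → Separation G (suc K) S
  balanced-separation with us , g , all∈ ← spanning T (proj₁ (proj₂ isTree)) (fromℕ< (proj₁ isTree)) =
    separate g bag (λ _ _ b → b) (λ _ _ _ b _ _ → b)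
      (λ v → let x , b = covV v in x , all∈ x , b)
      (λ v w e → let x , bv , bw = covE v w e in x , all∈ x , bv , bw)
      (λ {x} _ → ℕₚ.≤-<-trans
        (≤-trans (count-mono {q = bag x} λ v → ∧-conicalʳ (S v) _) (bag-size x))
        (ℕₚ.m<m+n (suc K) (s≤s z≤n)))

-- Trees given by parent functions

children : ∀ {m} → (Fin m → Fin (suc m)) → Fin (suc m) → ℕ
children {m} par x = countTrue m (λ i → isYes (par i ≟ x))

-- The rooted tree with root zero in which suc i has the parent par i, an earlier node.
module ParentTree {m} (par : Fin m → Fin (suc m)) (par≤ : ∀ i → toℕ (par i) ≤ toℕ i) where

  childOf : Fin (suc m) → Fin (suc m) → Bool
  childOf zero    y = false
  childOf (suc i) y = isYes (par i ≟ y)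

  childOf⇒> : ∀ x y → childOf x y ≡ true → toℕ y < toℕ x
  childOf⇒> (suc i) y t with refl ← isYes⁻ (par i ≟ y) t = s≤s (par≤ i)

  parent-unique : ∀ x y z → childOf x y ≡ true → childOf x z ≡ true → y ≡ z
  parent-unique (suc i) y z t t′ = trans (≡-sym (isYes⁻ (par i ≟ y) t)) (isYes⁻ (par i ≟ z) t′)

  tree : Graph (suc m)
  tree = record
    { adj = λ x y → childOf x y ∨ childOf y x
    ; sym = λ x y → ∨-comm (childOf x y) (childOf y x)
    ; irrefl = λ x → ¬-not λ t → ℕₚ.<-irrefl refl (childOf⇒> x x (diagonal (childOf x x) t)) }
    where
    diagonal : ∀ b → b ∨ b ≡ true → b ≡ true
    diagonal true _ = refl

  degree-children : ∀ x → degree tree x ≤ countTrue (suc m) (childOf x) + children par x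
  degree-children x = count-∨ (childOf x) (λ y → childOf y x)

  degree-root : degree tree zero ≤ children par zero
  degree-root = ≤-trans (degree-children zero)
    (ℕₚ.+-monoˡ-≤ _ (≤-reflexive (count-false (childOf zero) λ _ → refl)))

  degree-nonroot : ∀ i → degree tree (suc i) ≤ suc (children par (suc i))
  degree-nonroot i = ≤-trans (degree-children (suc i))
    (ℕₚ.+-monoˡ-≤ _ (count-unique (childOf (suc i)) (parent-unique (suc i))))

  Adjacent : Fin (suc m) → Fin (suc m) → Set
  Adjacent x y = adj tree x y ≡ true

  connected : Connected tree
  connected x y = toWalk (toRoot (toℕ x) x ≤-refl ◅◅
                          Star.reverse (λ {a} {b} → trans (Graph.sym tree b a)) (toRoot (toℕ y) y ≤-refl))
    where
    -- The bound `b` is fuel: a parent has a smaller index but is not a structurally smaller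
    -- argument.
    toRoot : ∀ b x → toℕ x ≤ b → Star Adjacent x zero
    toRoot b       zero    _         = ε
    toRoot (suc b) (suc i) (s≤s i≤b) =
      ∨⁺ˡ (isYes⁺ (par i ≟ par i) refl) ◅ toRoot b (par i) (≤-trans (par≤ i) i≤b)
    toWalk : ∀ {x y} → Star Adjacent x y → WalkWithin tree (λ _ → ⊤) x y
    toWalk ε       = here _
    toWalk (e ◅ s) = step _ e (toWalk s)

  -- By uniqueness of parents, this rules out a step down followed by a step up, which would return
  -- to the same node.
  NonBacktracking : List (Fin (suc m)) → Set
  NonBacktracking (x ∷ y ∷ z ∷ zs) = x ≢ z × NonBacktracking (y ∷ z ∷ zs)
  NonBacktracking _                = ⊤

  nonBacktracking-∷ʳ : ∀ {s} xs → Unique xs → All (s ≢_) xs → NonBacktracking (xs ++ [ s ])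
  nonBacktracking-∷ʳ []               _ _             = _
  nonBacktracking-∷ʳ (x ∷ [])         _ _             = _
  nonBacktracking-∷ʳ (x ∷ y ∷ [])     _ (s≢x ∷ _)     = (λ e → s≢x (≡-sym e)) , _
  nonBacktracking-∷ʳ (x ∷ y ∷ z ∷ zs) ((_ ∷ x≢z ∷ _) ∷ u) (_ ∷ s≢) = x≢z , nonBacktracking-∷ʳ (y ∷ z ∷ zs) u s≢

  lastOf : Fin (suc m) → List (Fin (suc m)) → Fin (suc m)
  lastOf y []       = y
  lastOf y (z ∷ zs) = lastOf z zs

  lastOf-∈ : ∀ y zs → lastOf y zs ∈ y ∷ zs
  lastOf-∈ y []       = here refl
  lastOf-∈ y (z ∷ zs) = there (lastOf-∈ z zs)

  -- A walk that does not backtrack can only go away from the root once it has done so.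
  descend : ∀ x y zs e → childOf y x ≡ true → IsPathList tree (y ∷ zs ++ [ e ]) →
            NonBacktracking (x ∷ y ∷ zs ++ [ e ]) → toℕ x < toℕ e × childOf e (lastOf y zs) ≡ true
  descend x y [] e yx (ye , _) (x≢e , _) with ∨⁻ {childOf y e} ye
  ... | inj₁ t = ⊥-elim (x≢e (parent-unique y x e yx t))
  ... | inj₂ t = ℕₚ.<-trans (childOf⇒> y x yx) (childOf⇒> e y t) , t
  descend x y (z ∷ zs) e yx (yz , π) (x≢z , nb) with ∨⁻ {childOf y z} yz
  ... | inj₁ t = ⊥-elim (x≢z (parent-unique y x z yx t))
  ... | inj₂ t with y<e , last ← descend y z zs e t π nb = ℕₚ.<-trans (childOf⇒> y x yx) y<e , last

  -- Either every step goes up, and the indices decrease all the way, or some step goes down, and by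
  -- `descend` so does the last one.
  climb : ∀ x y zs e → IsPathList tree (x ∷ y ∷ zs ++ [ e ]) → NonBacktracking (x ∷ y ∷ zs ++ [ e ]) →
          toℕ e < toℕ x ⊎ childOf e (lastOf y zs) ≡ true
  climb x y zs e (xy , π) nb with ∨⁻ {childOf x y} xy
  ... | inj₂ t = inj₂ (proj₂ (descend x y zs e t π nb))
  climb x y [] e (xy , ye , _) nb | inj₁ t with ∨⁻ {childOf y e} ye
  ...   | inj₁ t′ = inj₁ (ℕₚ.<-trans (childOf⇒> y e t′) (childOf⇒> x y t))
  ...   | inj₂ t′ = inj₂ t′
  climb x y (z ∷ zs) e (xy , π) (_ , nb) | inj₁ t with climb y z zs e π nb
  ...   | inj₁ e<y  = inj₁ (ℕₚ.<-trans e<y (childOf⇒> x y t))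
  ...   | inj₂ last = inj₂ last

  acyclic : Acyclic tree
  acyclic record { start = s ; rest = y ∷ z ∷ zs ; uniq = (s≢y ∷ s≢z ∷ s≢) ∷ (y≢ ∷ u) ; closed = sy , π }
    with nb ← (s≢z , nonBacktracking-∷ʳ (y ∷ z ∷ zs) (y≢ ∷ u) (s≢y ∷ s≢z ∷ s≢)) with ∨⁻ {childOf s y} sy
  ... | inj₂ t = ℕₚ.<-irrefl refl (proj₁ (descend s y (z ∷ zs) s t π nb))
  ... | inj₁ t with climb s y (z ∷ zs) s (sy , π) nb
  ...   | inj₁ s<s  = ℕₚ.<-irrefl refl s<s
  -- The cycle leaves `s` for its parent and comes back from its parent, so its second and last
  -- nodes coincide.
  ...   | inj₂ last = All.lookup y≢ (lastOf-∈ z zs) (parent-unique s y _ t last)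
  acyclic record { rest = [] ; long = () }
  acyclic record { rest = _ ∷ [] ; long = s≤s () }

  isTree : IsTree tree
  isTree = s≤s z≤n , connected , acyclic

  maxDegree-bound : ∀ {b} → children par zero ≤ b → (∀ i → children par (suc i) < b) → maxDegree tree ≤ b
  maxDegree-bound r c = maxOver-lub (degree tree) λ
    { zero    → ≤-trans degree-root r
    ; (suc i) → ≤-trans (degree-nonroot i) (c i) }

-- Counting unions and intersections

module _ {n} (p q r s : Subset n) where

  private
    unit : ∀ a b c d → a + b + (c + (d + 0)) + 0 ≡ c + d + (a + (b + 0))
    unit = solve-∀

  -- The identity |p| + |q| = |p ∪ q| + |p ∩ q|, with `r` containing the union and `s` the
  -- intersection.
  count-modular : (∀ v → p v ≡ true → r v ≡ true) → (∀ v → q v ≡ true → r v ≡ true) →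
    (∀ v → p v ≡ true → q v ≡ true → s v ≡ true) →
    countTrue n p + countTrue n q ≤ countTrue n r + countTrue n s
  count-modular p⊆r q⊆r p∩q⊆s = linear 0
    (total-mono (p ∷ q ∷ []) (r ∷ s ∷ []) λ v → bits (p v) (q v) (p⊆r v) (q⊆r v) (p∩q⊆s v))
    (unit (countTrue n p) (countTrue n q) (countTrue n r) (countTrue n s))
    where
    bits : ∀ a b {c d} → (a ≡ true → c ≡ true) → (b ≡ true → c ≡ true) →
           (a ≡ true → b ≡ true → d ≡ true) → ⟦ a ⟧ + (⟦ b ⟧ + 0) ≤ ⟦ c ⟧ + (⟦ d ⟧ + 0)
    bits false false f g h = z≤n
    bits true  false f g h rewrite f refl = s≤s z≤n
    bits false true  f g h rewrite g refl = s≤s z≤n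
    bits true  true  f g h rewrite f refl | h refl refl = ≤-refl

  -- The same identity applied to `r` and `s`: `p` lies in their union and `q` in their
  -- intersection.
  count-comodular : (∀ v → p v ≡ true → r v ≡ true ⊎ s v ≡ true) →
    (∀ v → q v ≡ true → r v ≡ true × s v ≡ true) →
    countTrue n p + countTrue n q ≤ countTrue n r + countTrue n s
  count-comodular p⊆r∪s q⊆r∩s = linear 0
    (total-mono (p ∷ q ∷ []) (r ∷ s ∷ []) λ v → bits (p v) (q v) (p⊆r∪s v) (q⊆r∩s v))
    (unit (countTrue n p) (countTrue n q) (countTrue n r) (countTrue n s))
    where
    bits : ∀ a b {c d} → (a ≡ true → c ≡ true ⊎ d ≡ true) → (b ≡ true → c ≡ true × d ≡ true) →
           ⟦ a ⟧ + (⟦ b ⟧ + 0) ≤ ⟦ c ⟧ + (⟦ d ⟧ + 0)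
    bits false false f g = z≤n
    bits true  false f g with f refl
    ... | inj₁ refl = s≤s z≤n
    ... | inj₂ refl = ℕₚ.m≤n+m _ _
    bits a true f g with refl , refl ← g refl = ℕₚ.+-monoˡ-≤ 1 (bit a)
      where
      bit : ∀ a → ⟦ a ⟧ ≤ 1
      bit true  = ≤-refl
      bit false = z≤n

count-disjoint : ∀ {n} (p q r : Subset n) →
  (∀ v → p v ≡ true → r v ≡ true) → (∀ v → q v ≡ true → r v ≡ true) →
  (∀ v → p v ≡ true → q v ≡ false) → countTrue n p + countTrue n q ≤ countTrue n r
count-disjoint {n} p q r p⊆r q⊆r p∩q = ≤-trans
  (count-modular p q r (λ _ → false) p⊆r q⊆r λ v t t′ → absurd t′ (p∩q v t))
  (≤-reflexive (trans (cong (countTrue n r +_) (count-false {n} _ λ _ → refl)) (ℕₚ.+-identityʳ _)))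

count-∃ : ∀ {n} (p : Subset n) v → p v ≡ true → 1 ≤ countTrue n p
count-∃ p zero    t rewrite t = s≤s z≤n
count-∃ p (suc v) t = ≤-trans (count-∃ (λ w → p (suc w)) v t) (ℕₚ.m≤n+m _ _)

-- Rooted tree-partitions and their bounds

Child : ∀ {m} → (Fin m → Fin (suc m)) → Fin (suc m) → Fin (suc m) → Set
Child par x y = ∃ λ i → x ≡ suc i × par i ≡ y

-- Equality or adjacency in the rooted tree, phrased by parent equations so that it transfers along
-- every map respecting parents.
Near : ∀ {m} → (Fin m → Fin (suc m)) → Fin (suc m) → Fin (suc m) → Set
Near par x y = x ≡ y ⊎ Child par x y ⊎ Child par y x

near-map : ∀ {m m′ par par′} (ι : Fin (suc m) → Fin (suc m′)) →
  (∀ i → ∃ λ j → ι (suc i) ≡ suc j × par′ j ≡ ι (par i)) →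
  ∀ {x y} → Near par x y → Near par′ (ι x) (ι y)
near-map ι h (inj₁ e) = inj₁ (cong ι e)
near-map ι h (inj₂ (inj₁ (i , refl , refl))) = inj₂ (inj₁ (h i))
near-map ι h (inj₂ (inj₂ (i , refl , refl))) = inj₂ (inj₂ (h i))

part : ∀ {n m} → Subset n → (Fin n → Fin m) → Fin m → Subset n
part W place x v = W v ∧ isYes (place v ≟ x)

part⁺ : ∀ {n m} {W : Subset n} (place : Fin n → Fin m) {x v} → W v ≡ true → place v ≡ x → part W place x v ≡ true
part⁺ place {x} {v} Wv e = ∧⁺ Wv (isYes⁺ (place v ≟ x) e)

part⁻ : ∀ {n m} {W : Subset n} (place : Fin n → Fin m) {x} v → part W place x v ≡ true → W v ≡ true × place v ≡ x
part⁻ {W = W} place {x} v t = ∧-conicalˡ (W v) _ t , isYes⁻ (place v ≟ x) (∧-conicalʳ (W v) _ t)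

-- The bounds on the root leave room for gluing two roots together and for giving the root a parent.
record RootedPartition {n} (G : Graph n) (K d : ℕ) (W S : Subset n) : Set where
  field
    size        : ℕ
    par         : Fin size → Fin (suc size)
    par≤        : ∀ i → toℕ (par i) ≤ toℕ i
    place       : Fin n → Fin (suc size)
    edges       : ∀ v w → W v ≡ true → W w ≡ true → adj G v w ≡ true → Near par (place v) (place w)
    at-root     : ∀ v → S v ≡ true → place v ≡ zero
    root-size   : 2 * countTrue n (part W place zero) + 4 * K ≤ 3 * countTrue n S
    root-degree : 2 * K * suc (children par zero) ≤ countTrue n S
    part-size   : ∀ i → countTrue n (part W place (suc i)) ≤ 18 * K * d
    degree<     : ∀ i → children par (suc i) < 6 * d

module _ {n} {G : Graph n} {k d : ℕ} {W S : Subset n}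
  (P : RootedPartition G (suc k) d W S) (S≤ : countTrue n S ≤ 12 * suc k * d) where
  open RootedPartition P

  -- The origin of the factor 18: it is 3/2 of the 12 in the bound on `S`.
  parts≤ : ∀ x → countTrue n (part W place x) ≤ 18 * suc k * d
  parts≤ zero = ℕₚ.*-cancelˡ-≤ 2 (linear (4 * suc k) (+-mono-≤ root-size (*-monoʳ-≤ 3 S≤))
    (arith (countTrue n (part W place zero)) (suc k) d (countTrue n S)))
    where
    arith : ∀ p K d s → 2 * p + (3 * s + 3 * (12 * K * d)) + 4 * K ≡ 2 * (18 * K * d) + (2 * p + 4 * K + 3 * s)
    arith = solve-∀
  parts≤ (suc i) = part-size i

  -- Half of 12 gives the factor 6, and strictness keeps one unit for the edge to a parent.
  children< : ∀ x → children par x < 6 * d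
  children< zero = ℕₚ.*-cancelˡ-≤ (2 * suc k)
    (≤-trans root-degree (≤-trans S≤ (≤-reflexive (arith (suc k) d))))
    where
    arith : ∀ K d → 12 * K * d ≡ 2 * K * (6 * d)
    arith = solve-∀
  children< (suc i) = degree< i

_∖_ : ∀ {n} → Subset n → Subset n → Subset n
(p ∖ q) v = p v ∧ not (q v)

∖⁺ : ∀ {n} {p q : Subset n} {v} → p v ≡ true → q v ≡ false → (p ∖ q) v ≡ true
∖⁺ pv ¬qv = ∧⁺ pv (cong not ¬qv)

∖⇒∉ : ∀ {n} (p q : Subset n) v → (p ∖ q) v ≡ true → q v ≡ false
∖⇒∉ p q v t with q v | ∧-conicalʳ (p v) _ t
... | false | _ = refl

-- Partitions whose root part is S

module _ {n} (G : Graph n) (K d : ℕ) (W S : Subset n) (S⊆W : ∀ v → S v ≡ true → W v ≡ true) where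

  private
    arith₁ : ∀ p K s → 2 * p + 4 * K + (2 * s + s) + 0 ≡ 3 * s + (2 * p + 4 * K)
    arith₁ = solve-∀
    arith₂ : ∀ K → 2 * K * 2 ≡ 4 * K
    arith₂ = solve-∀

  two-parts : 1 ≤ d → 4 * K ≤ countTrue n S → countTrue n (W ∖ S) ≤ 18 * K * d → RootedPartition G K d W S
  two-parts 1≤d S≥ rest≤ = record
    { size = 1 ; par = λ _ → zero ; par≤ = λ _ → z≤n ; place = place
    ; edges = λ v w _ _ _ → near v w
    ; at-root = λ v Sv → cong (λ b → if b then zero else suc zero) Sv
    ; root-size = linear 0 (+-mono-≤ (*-monoʳ-≤ 2 (count-mono rootpart)) S≥)
        (arith₁ (countTrue n (part W place zero)) K (countTrue n S))
    ; root-degree = ≤-trans (≤-reflexive (arith₂ K)) S≥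
    ; part-size = λ { zero → ≤-trans (count-mono childpart) rest≤ }
    ; degree< = λ { zero → ≤-trans 1≤d (ℕₚ.m≤m+n d _) } }
    where
    place : Fin n → Fin 2
    place v = if S v then zero else suc zero
    near : ∀ v w → Near (λ _ → zero) (place v) (place w)
    near v w with S v | S w
    ... | true  | true  = inj₁ refl
    ... | true  | false = inj₂ (inj₂ (zero , refl , refl))
    ... | false | true  = inj₂ (inj₁ (zero , refl , refl))
    ... | false | false = inj₁ refl
    rootpart : ∀ v → part W place zero v ≡ true → S v ≡ true
    rootpart v t with S v | proj₂ (part⁻ {W = W} place v t)
    ... | true | _ = refl
    childpart : ∀ v → part W place (suc zero) v ≡ true → (W ∖ S) v ≡ true
    childpart v t with part⁻ {W = W} place v t
    ... | Wv , e with S v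
    ...   | false = ∧⁺ Wv refl

  -- An edge leaving `S` ends in `R`, hence in the root part of `P`, whose node becomes the only
  -- child of the new root. The bound on `R` makes the old root obey the limits for a node with a
  -- parent.
  new-root : 1 ≤ K → 4 * K ≤ countTrue n S → (R : Subset n) → countTrue n R ≤ 12 * K * d →
    (∀ v w → S v ≡ true → adj G v w ≡ true → (W ∖ S) w ≡ true → R w ≡ true) →
    RootedPartition G K d (W ∖ S) R → RootedPartition G K d W S
  new-root (s≤s _) S≥ R R≤ neighbours P = record
    { size = suc P.size ; par = par ; par≤ = λ { zero → z≤n ; (suc i) → s≤s (P.par≤ i) } ; place = place
    ; edges = edges
    ; at-root = λ v Sv → cong (λ b → if b then zero else suc (P.place v)) Sv
    ; root-size = linear 0 (+-mono-≤ (*-monoʳ-≤ 2 (count-mono rootpart)) S≥)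
        (arith₁ (countTrue n (part W place zero)) K (countTrue n S))
    -- Exactly one node has parent `zero`, since the parents inherited from `P` are all shifted to
    -- successors.
    ; root-degree = ≤-trans (≤-reflexive
        (trans (cong (λ c → 2 * K * suc (suc c)) (count-false (λ i → isYes (suc (P.par i) ≟ zero)) λ _ → refl))
               (arith₂ K))) S≥
    ; part-size = λ x → ≤-trans (count-mono (lowerpart x)) (parts≤ P R≤ x)
    ; degree< = λ x → ≤-trans
        (s≤s (count-mono {p = λ i → isYes (suc (P.par i) ≟ suc x)} (lowerchild x))) (children< P R≤ x) }
    where
    module P = RootedPartition P
    par : Fin (suc P.size) → Fin (suc (suc P.size))
    par zero    = zero
    par (suc i) = suc (P.par i)
    place : Fin n → Fin (suc (suc P.size))
    place v = if S v then zero else suc (P.place v)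
    edges : ∀ v w → W v ≡ true → W w ≡ true → adj G v w ≡ true → Near par (place v) (place w)
    edges v w Wv Ww e with S v in Sv | S w in Sw
    ... | true  | true  = inj₁ refl
    ... | true  | false = inj₂ (inj₂ (zero ,
      cong suc (P.at-root w (neighbours v w Sv e (∖⁺ {p = W} {S} Ww Sw))) , refl))
    ... | false | true  = inj₂ (inj₁ (zero ,
      cong suc (P.at-root v (neighbours w v Sw (trans (Graph.sym G w v) e) (∖⁺ {p = W} {S} Wv Sv))) , refl))
    ... | false | false = near-map suc (λ i → suc i , refl , refl)
      (P.edges v w (∖⁺ {p = W} {S} Wv Sv) (∖⁺ {p = W} {S} Ww Sw) e)
    rootpart : ∀ v → part W place zero v ≡ true → S v ≡ true
    rootpart v t with S v | proj₂ (part⁻ {W = W} place v t)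
    ... | true | _ = refl
    lowerpart : ∀ x v → part W place (suc x) v ≡ true → part (W ∖ S) P.place x v ≡ true
    lowerpart x v t with part⁻ {W = W} place v t
    ... | Wv , e with S v
    ...   | false = ∧⁺ (∧⁺ Wv refl) (isYes⁺ (P.place v ≟ x) (suc-injective e))
    lowerchild : ∀ x i → isYes (suc (P.par i) ≟ suc x) ≡ true → isYes (P.par i ≟ x) ≡ true
    lowerchild x i t = isYes⁺ (P.par i ≟ x) (suc-injective (isYes⁻ (suc (P.par i) ≟ suc x) t))

-- Identifying the roots of two trees

↑-cases : ∀ m {k} {P : Fin (m + k) → Set} → (∀ i → P (i ↑ˡ k)) → (∀ j → P (m ↑ʳ j)) → ∀ i → P i
↑-cases m {k} {P} l r i with splitAt m i in e
... | inj₁ j = subst P (splitAt⁻¹-↑ˡ e) (l j)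
... | inj₂ j = subst P (splitAt⁻¹-↑ʳ e) (r j)

↑ˡ≢↑ʳ : ∀ {m k} (i : Fin m) (j : Fin k) → i ↑ˡ k ≢ m ↑ʳ j
↑ˡ≢↑ʳ {m} {k} i j e
  with trans (≡-sym (splitAt-↑ˡ m i k)) (trans (cong (splitAt m) e) (splitAt-↑ʳ m k j))
... | ()

module RootGluing {m₁ m₂} (par₁ : Fin m₁ → Fin (suc m₁)) (par₂ : Fin m₂ → Fin (suc m₂)) where

  ι₁ : Fin (suc m₁) → Fin (suc (m₁ + m₂))
  ι₁ x = x ↑ˡ m₂

  ι₂ : Fin (suc m₂) → Fin (suc (m₁ + m₂))
  ι₂ zero    = zero
  ι₂ (suc j) = suc (m₁ ↑ʳ j)

  par : Fin (m₁ + m₂) → Fin (suc (m₁ + m₂))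
  par i = [ (λ j → ι₁ (par₁ j)) , (λ j → ι₂ (par₂ j)) ]′ (splitAt m₁ i)

  par-↑ˡ : ∀ i → par (i ↑ˡ m₂) ≡ ι₁ (par₁ i)
  par-↑ˡ i rewrite splitAt-↑ˡ m₁ i m₂ = refl

  par-↑ʳ : ∀ j → par (m₁ ↑ʳ j) ≡ ι₂ (par₂ j)
  par-↑ʳ j rewrite splitAt-↑ʳ m₁ m₂ j = refl

  ι₁-injective : ∀ {x y} → ι₁ x ≡ ι₁ y → x ≡ y
  ι₁-injective {x} {y} = ↑ˡ-injective m₂ x y

  ι₂-injective : ∀ {x y} → ι₂ x ≡ ι₂ y → x ≡ y
  ι₂-injective {zero}  {zero}  e = refl
  ι₂-injective {suc x} {suc y} e = cong suc (↑ʳ-injective m₁ x y (suc-injective e))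

  ι₁≢ι₂ : ∀ x j → ι₁ x ≢ ι₂ (suc j)
  ι₁≢ι₂ (suc i) j e = ↑ˡ≢↑ʳ i j (suc-injective e)

  ι₂≢ι₁ : ∀ y i → ι₂ y ≢ ι₁ (suc i)
  ι₂≢ι₁ (suc j) i e = ↑ˡ≢↑ʳ i j (suc-injective (≡-sym e))

  par≤ : (∀ i → toℕ (par₁ i) ≤ toℕ i) → (∀ j → toℕ (par₂ j) ≤ toℕ j) → ∀ i → toℕ (par i) ≤ toℕ i
  par≤ h₁ h₂ = ↑-cases m₁ left right
    where
    left : ∀ i → toℕ (par (i ↑ˡ m₂)) ≤ toℕ (i ↑ˡ m₂)
    left i rewrite par-↑ˡ i | toℕ-↑ˡ (par₁ i) m₂ | toℕ-↑ˡ i m₂ = h₁ i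
    -- Only an inequality: the root stays at `zero` while the other nodes move up by `m₁`.
    shift : ∀ y → toℕ (ι₂ y) ≤ m₁ + toℕ y
    shift zero    = z≤n
    shift (suc j) = ≤-reflexive (trans (cong suc (toℕ-↑ʳ m₁ j)) (≡-sym (ℕₚ.+-suc m₁ (toℕ j))))
    right : ∀ j → toℕ (par (m₁ ↑ʳ j)) ≤ toℕ (m₁ ↑ʳ j)
    right j rewrite par-↑ʳ j | toℕ-↑ʳ m₁ j = ≤-trans (shift (par₂ j)) (ℕₚ.+-monoʳ-≤ m₁ (h₂ j))

  near₁ : ∀ {x y} → Near par₁ x y → Near par (ι₁ x) (ι₁ y)
  near₁ = near-map ι₁ λ i → i ↑ˡ m₂ , refl , par-↑ˡ i

  near₂ : ∀ {x y} → Near par₂ x y → Near par (ι₂ x) (ι₂ y)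
  near₂ = near-map ι₂ λ j → m₁ ↑ʳ j , refl , par-↑ʳ j

  children≤ : ∀ x {a b} → countTrue m₁ (λ i → isYes (ι₁ (par₁ i) ≟ x)) ≤ a →
                          countTrue m₂ (λ j → isYes (ι₂ (par₂ j) ≟ x)) ≤ b → children par x ≤ a + b
  children≤ x a b = ≤-trans (≤-reflexive (count-++ m₁ (λ i → isYes (par i ≟ x)))) (+-mono-≤
    (≤-trans (count-mono λ i → subst (λ y → isYes (y ≟ x) ≡ true) (par-↑ˡ i)) a)
    (≤-trans (count-mono λ j → subst (λ y → isYes (y ≟ x) ≡ true) (par-↑ʳ j)) b))

  private
    reflect : ∀ {m} {A B : Fin m → Set} (A? : ∀ i → Dec (A i)) (B? : ∀ i → Dec (B i)) → (∀ i → A i → B i) →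
              countTrue m (λ i → isYes (A? i)) ≤ countTrue m (λ i → isYes (B? i))
    reflect A? B? f = count-mono λ i t → isYes⁺ (B? i) (f i (isYes⁻ (A? i) t))

    none : ∀ {m} {A : Fin m → Set} (A? : ∀ i → Dec (A i)) → (∀ i → ¬ A i) → countTrue m (λ i → isYes (A? i)) ≤ 0
    none A? ¬A = ≤-reflexive (count-false _ λ i → ¬-not λ t → ¬A i (isYes⁻ (A? i) t))

  children-root : children par zero ≤ children par₁ zero + children par₂ zero
  children-root = children≤ zero
    (reflect (λ i → ι₁ (par₁ i) ≟ zero) (λ i → par₁ i ≟ zero) λ i → ι₁-injective {par₁ i} {zero})
    (reflect (λ j → ι₂ (par₂ j) ≟ zero) (λ j → par₂ j ≟ zero) λ j → ι₂-injective {par₂ j} {zero})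

  children-↑ˡ : ∀ i → children par (ι₁ (suc i)) ≤ children par₁ (suc i)
  children-↑ˡ i = ≤-trans (children≤ (ι₁ (suc i))
    (reflect (λ k → ι₁ (par₁ k) ≟ ι₁ (suc i)) (λ k → par₁ k ≟ suc i) λ k → ι₁-injective {par₁ k} {suc i})
    (none (λ j → ι₂ (par₂ j) ≟ ι₁ (suc i)) λ j → ι₂≢ι₁ (par₂ j) i)) (≤-reflexive (ℕₚ.+-identityʳ _))

  children-↑ʳ : ∀ j → children par (ι₂ (suc j)) ≤ children par₂ (suc j)
  children-↑ʳ j = children≤ (ι₂ (suc j))
    (none (λ i → ι₁ (par₁ i) ≟ ι₂ (suc j)) λ i → ι₁≢ι₂ (par₁ i) j)
    (reflect (λ k → ι₂ (par₂ k) ≟ ι₂ (suc j)) (λ k → par₂ k ≟ suc j) λ k → ι₂-injective {par₂ k} {suc j})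

-- Gluing partitions along a separation

module _ {n} {G : Graph n} {K : ℕ} {W S : Subset n} (sep : Separation G K S) where
  open Separation sep

  left right border left-root right-root : Subset n
  left v       = W v ∧ H v
  right v      = W v ∧ (not (H v) ∨ X v)
  border v     = X v ∧ W v
  left-root v  = left v ∧ (S v ∨ X v)
  right-root v = right v ∧ (S v ∨ X v)

  border-left : ∀ v → border v ≡ true → left-root v ≡ true
  border-left v t with Xv ← ∧-conicalˡ (X v) _ t =
    ∧⁺ (∧⁺ (∧-conicalʳ (X v) _ t) (X⊆H v Xv)) (∨⁺ʳ {S v} Xv)

  border-right : ∀ v → border v ≡ true → right-root v ≡ true
  border-right v t with Xv ← ∧-conicalˡ (X v) _ t =
    ∧⁺ (∧⁺ (∧-conicalʳ (X v) _ t) (∨⁺ʳ {not (H v)} Xv)) (∨⁺ʳ {S v} Xv)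

  left∩right : ∀ v → left v ≡ true → right v ≡ true → X v ≡ true
  left∩right v l r with ∨⁻ {not (H v)} (∧-conicalʳ (W v) _ r)
  ... | inj₁ ¬Hv = ⊥-elim (not-¬ {H v} refl (trans (∧-conicalʳ (W v) _ l) (≡-sym ¬Hv)))
  ... | inj₂ Xv  = Xv

  border≤ : countTrue n border ≤ K
  border≤ = ≤-trans (count-mono λ v → ∧-conicalˡ (X v) _) X-size

  -- The two sets lie within `S` and the border and overlap only in the border, which is therefore
  -- paid for twice.
  roots≤ : countTrue n left-root + countTrue n right-root ≤
           countTrue n S + countTrue n border + countTrue n border
  roots≤ = ≤-trans
    (count-modular left-root right-root (λ v → S v ∨ border v) border
      (λ v t → S∪border v (∧-conicalˡ (W v) _ (∧-conicalˡ (left v) _ t)) (∧-conicalʳ (left v) _ t))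
      (λ v t → S∪border v (∧-conicalˡ (W v) _ (∧-conicalˡ (right v) _ t)) (∧-conicalʳ (right v) _ t))
      (λ v l r → ∧⁺ (left∩right v (∧-conicalˡ (left v) _ l) (∧-conicalˡ (right v) _ r))
                    (∧-conicalˡ (W v) _ (∧-conicalˡ (left v) _ l))))
    (ℕₚ.+-monoˡ-≤ _ (count-∨ S border))
    where
    S∪border : ∀ v → W v ≡ true → S v ∨ X v ≡ true → S v ∨ border v ≡ true
    S∪border v Wv t with ∨⁻ {S v} t
    ... | inj₁ Sv = ∨⁺ˡ Sv
    ... | inj₂ Xv = ∨⁺ʳ {S v} (∧⁺ Xv Wv)

  glue : ∀ {d} → (∀ v → S v ≡ true → W v ≡ true) →
         RootedPartition G K d left left-root → RootedPartition G K d right right-root →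
         RootedPartition G K d W S
  glue {d} S⊆W P₁ P₂ = record
    { size = _ ; par = par ; par≤ = par≤ P₁.par≤ P₂.par≤ ; place = place
    ; edges = edges ; at-root = at-root
    ; root-size = linear 0
        (+-mono-≤ (*-monoʳ-≤ 2 root-parts) (+-mono-≤ P₁.root-size (+-mono-≤ P₂.root-size
          (+-mono-≤ (*-monoʳ-≤ 3 roots≤) (*-monoʳ-≤ 4 border≤)))))
        (arith₁ (countTrue n (part W place zero)) (countTrue n (part left P₁.place zero))
          (countTrue n (part right P₂.place zero)) K (countTrue n S) (countTrue n left-root)
          (countTrue n right-root) (countTrue n border))
    ; root-degree = linear 0
        (+-mono-≤ (*-monoʳ-≤ (2 * K) children-root) (+-mono-≤ P₁.root-degree (+-mono-≤ P₂.root-degree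
          (+-mono-≤ roots≤ (*-monoʳ-≤ 2 border≤)))))
        (arith₂ (children par zero) (children P₁.par zero) (children P₂.par zero) K (countTrue n S)
          (countTrue n left-root) (countTrue n right-root) (countTrue n border))
    ; part-size = ↑-cases P₁.size
        (λ i → ≤-trans (count-mono (left-part i)) (P₁.part-size i))
        (λ j → ≤-trans (count-mono (right-part j)) (P₂.part-size j))
    ; degree< = ↑-cases P₁.size
        (λ i → ≤-trans (s≤s (children-↑ˡ i)) (P₁.degree< i))
        (λ j → ≤-trans (s≤s (children-↑ʳ j)) (P₂.degree< j)) }
    where
    arith₁ : ∀ p p₁ p₂ K s s₁ s₂ x →
      2 * p + 4 * K + (2 * (p₁ + p₂) + (3 * s₁ + (3 * s₂ + (3 * (s + x + x) + 4 * K)))) + 0 ≡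
      3 * s + (2 * (p + x) + (2 * p₁ + 4 * K + (2 * p₂ + 4 * K + (3 * (s₁ + s₂) + 4 * x))))
    arith₁ = solve-∀
    arith₂ : ∀ c c₁ c₂ K s s₁ s₂ x →
      2 * K * (1 + c) + (2 * K * (c₁ + c₂) + (s₁ + (s₂ + (s + x + x + 2 * K)))) + 0 ≡
      s + (2 * K * c + (2 * K * (1 + c₁) + (2 * K * (1 + c₂) + (s₁ + s₂ + 2 * x))))
    arith₂ = solve-∀
    module P₁ = RootedPartition P₁
    module P₂ = RootedPartition P₂
    open RootGluing P₁.par P₂.par

    choose : Bool → Fin n → Fin (suc (P₁.size + P₂.size))
    choose b v = if b then ι₁ (P₁.place v) else ι₂ (P₂.place v)

    -- Vertices of `X` lie in `H` and follow the left partition; for those in `W` either choice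
    -- gives the common root.
    place : Fin n → Fin (suc (P₁.size + P₂.size))
    place v = choose (H v) v

    on-left : ∀ {v} → H v ≡ true → place v ≡ ι₁ (P₁.place v)
    on-left {v} Hv = cong (λ b → choose b v) Hv

    on-right : ∀ {v} → H v ≡ false → place v ≡ ι₂ (P₂.place v)
    on-right {v} ¬Hv = cong (λ b → choose b v) ¬Hv

    right⁺ : ∀ {v} → W v ≡ true → H v ≡ false → right v ≡ true
    right⁺ Wv ¬Hv = ∧⁺ Wv (∨⁺ˡ (cong not ¬Hv))

    at-root : ∀ v → S v ≡ true → place v ≡ zero
    at-root v Sv with dichotomy (H v)
    ... | inj₁ Hv  = trans (on-left Hv) (cong ι₁ (P₁.at-root v (∧⁺ (∧⁺ (S⊆W v Sv) Hv) (∨⁺ˡ Sv))))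
    ... | inj₂ ¬Hv = trans (on-right ¬Hv) (cong ι₂ (P₂.at-root v (∧⁺ (right⁺ (S⊆W v Sv) ¬Hv) (∨⁺ˡ Sv))))

    -- An edge leaving `H` starts in `X`, at the common root. There the left and right placements
    -- agree, so the edge can be treated as one of the right side.
    crossing : ∀ v w → W v ≡ true → W w ≡ true → adj G v w ≡ true → H v ≡ true → H w ≡ false →
               place v ≡ ι₂ (P₂.place v) × Near P₂.par (P₂.place v) (P₂.place w)
    crossing v w Wv Ww e Hv ¬Hw =
      trans (on-left Hv) (trans (cong ι₁ (P₁.at-root v (border-left v b)))
        (cong ι₂ (≡-sym (P₂.at-root v (border-right v b))))) ,
      P₂.edges v w (∧-conicalˡ (right v) _ (border-right v b)) (right⁺ Ww ¬Hw) e
      where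
      b : border v ≡ true
      b = ∧⁺ (leave v w e Hv ¬Hw) Wv

    near-sym : ∀ {m} {par : Fin m → Fin (suc m)} {x y} → Near par x y → Near par y x
    near-sym (inj₁ e)        = inj₁ (≡-sym e)
    near-sym (inj₂ (inj₁ c)) = inj₂ (inj₂ c)
    near-sym (inj₂ (inj₂ c)) = inj₂ (inj₁ c)

    transport : ∀ {x x′ y y′} → x ≡ x′ → y ≡ y′ → Near par x′ y′ → Near par x y
    transport refl refl t = t

    edges : ∀ v w → W v ≡ true → W w ≡ true → adj G v w ≡ true → Near par (place v) (place w)
    edges v w Wv Ww e with dichotomy (H v) | dichotomy (H w)
    ... | inj₁ Hv | inj₁ Hw =
      transport (on-left Hv) (on-left Hw) (near₁ (P₁.edges v w (∧⁺ Wv Hv) (∧⁺ Ww Hw) e))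
    ... | inj₂ ¬Hv | inj₂ ¬Hw =
      transport (on-right ¬Hv) (on-right ¬Hw) (near₂ (P₂.edges v w (right⁺ Wv ¬Hv) (right⁺ Ww ¬Hw) e))
    ... | inj₁ Hv | inj₂ ¬Hw with q , near ← crossing v w Wv Ww e Hv ¬Hw =
      transport q (on-right ¬Hw) (near₂ near)
    ... | inj₂ ¬Hv | inj₁ Hw with q , near ← crossing w v Ww Wv (trans (Graph.sym G w v) e) Hw ¬Hv =
      transport (on-right ¬Hv) q (near₂ (near-sym near))

    left-part : ∀ i v → part W place (ι₁ (suc i)) v ≡ true → part left P₁.place (suc i) v ≡ true
    left-part i v t with part⁻ {W = W} place v t | dichotomy (H v)
    ... | Wv , e | inj₁ Hv  = part⁺ {W = left} P₁.place (∧⁺ Wv Hv)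
        (ι₁-injective {P₁.place v} {suc i} (trans (≡-sym (on-left Hv)) e))
    ... | Wv , e | inj₂ ¬Hv = ⊥-elim (ι₂≢ι₁ (P₂.place v) i (trans (≡-sym (on-right ¬Hv)) e))

    right-part : ∀ j v → part W place (ι₂ (suc j)) v ≡ true → part right P₂.place (suc j) v ≡ true
    right-part j v t with part⁻ {W = W} place v t | dichotomy (H v)
    ... | Wv , e | inj₁ Hv  = ⊥-elim (ι₁≢ι₂ (P₁.place v) j (trans (≡-sym (on-left Hv)) e))
    ... | Wv , e | inj₂ ¬Hv = part⁺ {W = right} P₂.place (right⁺ Wv ¬Hv)
        (ι₂-injective {P₂.place v} {suc j} (trans (≡-sym (on-right ¬Hv)) e))

    root-part : ∀ v → part W place zero v ≡ true →
                part left P₁.place zero v ≡ true ⊎ part right P₂.place zero v ≡ true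
    root-part v t with part⁻ {W = W} place v t | dichotomy (H v)
    ... | Wv , e | inj₁ Hv  = inj₁ (part⁺ {W = left} P₁.place (∧⁺ Wv Hv)
        (ι₁-injective {P₁.place v} {zero} (trans (≡-sym (on-left Hv)) e)))
    ... | Wv , e | inj₂ ¬Hv = inj₂ (part⁺ {W = right} P₂.place (right⁺ Wv ¬Hv)
        (ι₂-injective {P₂.place v} {zero} (trans (≡-sym (on-right ¬Hv)) e)))

    -- The border lies in both root parts, so the right-hand side counts it twice; `root-size`
    -- depends on this saving.
    root-parts : countTrue n (part W place zero) + countTrue n border ≤
                 countTrue n (part left P₁.place zero) + countTrue n (part right P₂.place zero)
    root-parts = count-comodular _ border _ _ root-part λ v b →
      part⁺ {W = left} P₁.place (∧-conicalˡ (left v) _ (border-left v b)) (P₁.at-root v (border-left v b)) ,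
      part⁺ {W = right} P₂.place (∧-conicalˡ (right v) _ (border-right v b)) (P₂.at-root v (border-right v b))

-- The induction on the size of W

four≤ : ∀ c K {d} → 1 ≤ d → 4 * K ≤ (4 + c) * K * d
four≤ c K 1≤d = ≤-trans (ℕₚ.*-monoˡ-≤ K (ℕₚ.m≤m+n 4 c))
  (≤-trans (≤-reflexive (≡-sym (ℕₚ.*-identityʳ ((4 + c) * K)))) (*-monoʳ-≤ ((4 + c) * K) 1≤d))

module _ {n} {G : Graph n} (D : TreeDecomposition G) (k : ℕ)
  (bag-size : ∀ x → countTrue n (TreeDecomposition.bag D x) ≤ suc k)
  (d : ℕ) (1≤d : 1 ≤ d) (degree≤ : ∀ v → degree G v ≤ d) where

  private
    K : ℕ
    K = suc k

  Partition : Subset n → Subset n → Set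
  Partition W S = (∀ v → S v ≡ true → W v ≡ true) → 4 * K ≤ countTrue n S →
                  countTrue n S ≤ 12 * K * d → RootedPartition G K d W S

  -- The neighbourhood of `S` may have fewer than 4K vertices, too few for the induction, so it is
  -- padded within the rest of `W`. There is room, because that rest has at least 18Kd vertices.
  expand : ∀ W S → (∀ R → Partition (W ∖ S) R) → (∀ v → S v ≡ true → W v ≡ true) →
           18 * K * d ≤ countTrue n (W ∖ S) → 4 * K ≤ countTrue n S → countTrue n S ≤ 12 * K →
           RootedPartition G K d W S
  expand W S recurse S⊆W large S≥ S≤ = result
    where
    neighbour : Subset n
    neighbour v = (W ∖ S) v ∧ some n (λ u → S u ∧ adj G u v)


    neighbours≤ : countTrue n neighbour ≤ 12 * K * d
    neighbours≤ = ≤-trans (count-mono λ v → ∧-conicalʳ ((W ∖ S) v) _)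
      (≤-trans (count-some S (adj G) d degree≤) (ℕₚ.*-monoˡ-≤ d S≤))

    target : ℕ
    target = 4 * K ⊔ countTrue n neighbour

    result : RootedPartition G K d W S
    result with R , N⊆R , R⊆ , e ← subset-of-size neighbour (W ∖ S) target
                  (λ v → ∧-conicalˡ ((W ∖ S) v) _) (ℕₚ.m≤n⊔m (4 * K) (countTrue n neighbour)) 
                  (ℕₚ.⊔-lub (≤-trans (four≤ 14 K 1≤d) large) (count-mono λ v → ∧-conicalˡ ((W ∖ S) v) _)) =
      new-root G K d W S S⊆W (s≤s z≤n) S≥ R R≤
        (λ v w Sv vw w∈ → N⊆R w (∧⁺ w∈ (some⁺ (λ u → S u ∧ adj G u w) v (∧⁺ Sv vw))))
        (recurse R R⊆ (≤-trans (ℕₚ.m≤m⊔n (4 * K) (countTrue n neighbour)) (≤-reflexive (≡-sym e))) R≤)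
      where
      R≤ : countTrue n R ≤ 12 * K * d
      R≤ = ≤-trans (≤-reflexive e) (ℕₚ.⊔-lub (four≤ 8 K 1≤d) neighbours≤)

  module _ {W S : Subset n} (sep : Separation G K S) (S⊆W : ∀ v → S v ≡ true → W v ≡ true)
    (large : 12 * K ≤ countTrue n S) where
    open Separation sep

    private
      inside outside : Subset n
      inside v = S v ∧ H v
      outside  = S ∖ H

      #left #right #inside #outside #left-root #right-root : ℕ
      #left       = countTrue n (left {W = W} sep)
      #right      = countTrue n (right {W = W} sep)
      #inside     = countTrue n inside
      #outside    = countTrue n outside
      #left-root  = countTrue n (left-root {W = W} sep)
      #right-root = countTrue n (right-root {W = W} sep)

      S≤in+out : countTrue n S ≤ #inside + #outside
      S≤in+out = ≤-trans (count-mono split) (count-∨ inside outside)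
        where
        split : ∀ v → S v ≡ true → inside v ∨ outside v ≡ true
        split v Sv with dichotomy (H v)
        ... | inj₁ Hv  = ∨⁺ˡ (∧⁺ Sv Hv)
        ... | inj₂ ¬Hv = ∨⁺ʳ {inside v} (∖⁺ {p = S} {H} Sv ¬Hv)

      outside⇒right-root : ∀ v → outside v ≡ true → right-root {W = W} sep v ≡ true
      outside⇒right-root v t with Sv ← ∧-conicalˡ (S v) _ t =
        ∧⁺ (∧⁺ (S⊆W v Sv) (∨⁺ˡ (∧-conicalʳ (S v) _ t))) (∨⁺ˡ Sv)

      4K≤outside : 4 * K ≤ #outside
      4K≤outside = linear 0 (+-mono-≤ large (+-mono-≤ S≤in+out H-high)) (arith K (countTrue n S) #inside #outside)
        where
        arith : ∀ K s i o → 4 * K + (s + (i + o + 8 * K)) + 0 ≡ o + (12 * K + (s + i))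
        arith = solve-∀

    -- The left side omits `outside`, which has at least 4K vertices.
    left< : #left < countTrue n W
    left< = linear (3 + 4 * k)
      (+-mono-≤ (count-disjoint (left {W = W} sep) outside W (λ v → ∧-conicalˡ (W v) _)
          (λ v t → S⊆W v (∧-conicalˡ (S v) _ t))
          λ v l → ¬-not λ o → absurd (∧-conicalʳ (W v) _ l) (∖⇒∉ S H v o))
        4K≤outside)
      (arith k #left #outside (countTrue n W))
      where
      arith : ∀ k l o w → 1 + l + (w + o) + (3 + 4 * k) ≡ w + (l + o + 4 * (1 + k))
      arith = solve-∀

    -- The right side meets `inside` only in `X`, so it omits at least 4K - K vertices of `S`.
    right< : #right < countTrue n W
    right< = linear (2 + 3 * k)
      (+-mono-≤ (count-modular (right {W = W} sep) inside W X (λ v → ∧-conicalˡ (W v) _)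
          (λ v t → S⊆W v (∧-conicalˡ (S v) _ t))
          λ v r i → left∩right {W = W} sep v (∧⁺ (∧-conicalˡ (W v) _ r) (∧-conicalʳ (S v) _ i)) r)
        (+-mono-≤ H-low X-size))
      (arith k #right #inside (countTrue n W) (countTrue n X))
      where
      arith : ∀ k r i w x → 1 + r + (w + x + (i + (1 + k))) + (2 + 3 * k) ≡ w + (r + i + (4 * (1 + k) + x))
      arith = solve-∀

    -- At most 8K vertices of `S` and K of `X` make 9K, which is below 12K.
    left-root≤ : #left-root ≤ countTrue n S
    left-root≤ = linear (3 * K) (+-mono-≤ (≤-trans (count-mono cover) (count-∨ inside X))
        (+-mono-≤ H-high (+-mono-≤ X-size large)))
      (arith #left-root #inside (countTrue n X) K (countTrue n S))
      where
      arith : ∀ l i x K s → l + (i + x + (8 * K + (K + s))) + 3 * K ≡ s + (l + (i + (x + 12 * K)))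
      arith = solve-∀
      cover : ∀ v → left-root {W = W} sep v ≡ true → inside v ∨ X v ≡ true
      cover v t with ∨⁻ {S v} (∧-conicalʳ (left {W = W} sep v) _ t)
      ... | inj₁ Sv = ∨⁺ˡ (∧⁺ Sv (∧-conicalʳ (W v) _ (∧-conicalˡ (left {W = W} sep v) _ t)))
      ... | inj₂ Xv = ∨⁺ʳ {inside v} Xv

    -- Adding `X` brings in at most K vertices, while at least 4K - K vertices of `inside` are lost.
    right-root≤ : #right-root ≤ countTrue n S
    right-root≤ = linear (2 * K)
        (+-mono-≤ (count-modular (right-root {W = W} sep) inside (λ v → S v ∨ X v) X
            (λ v → ∧-conicalʳ (right {W = W} sep v) _)
            (λ v t → ∨⁺ˡ (∧-conicalˡ (S v) _ t))
            λ v r i → let r′ = ∧-conicalˡ (right {W = W} sep v) _ r in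
              left∩right {W = W} sep v (∧⁺ (∧-conicalˡ (W v) _ r′) (∧-conicalʳ (S v) _ i)) r′)
          (+-mono-≤ (count-∨ S X) (+-mono-≤ H-low (*-monoʳ-≤ 2 X-size))))
        (arith #right-root #inside (countTrue n λ v → S v ∨ X v) (countTrue n X) K (countTrue n S))
      where
      arith : ∀ r i u x K s → r + (u + x + (s + x + (i + 2 * K))) + 2 * K ≡ s + (r + i + (u + (4 * K + 2 * x)))
      arith = solve-∀

    divide : countTrue n S ≤ 12 * K * d → Partition (left {W = W} sep) (left-root {W = W} sep) →
             Partition (right {W = W} sep) (right-root {W = W} sep) → RootedPartition G K d W S
    divide S≤ P₁ P₂ = glue sep S⊆W
      (P₁ (λ v → ∧-conicalˡ (left {W = W} sep v) _)
        (≤-trans H-low (count-mono inside⇒left-root)) (≤-trans left-root≤ S≤))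
      (P₂ (λ v → ∧-conicalˡ (right {W = W} sep v) _)
        (≤-trans 4K≤outside (count-mono outside⇒right-root)) (≤-trans right-root≤ S≤))
      where
      inside⇒left-root : ∀ v → inside v ≡ true → left-root {W = W} sep v ≡ true
      inside⇒left-root v t with Sv ← ∧-conicalˡ (S v) _ t =
        ∧⁺ (∧⁺ (S⊆W v Sv) (∧-conicalʳ (S v) _ t)) (∨⁺ˡ Sv)

  -- The strict bound `b` on the size of `W` is fuel. A small rest is dealt with first because the
  -- padding in `expand` needs a large one.
  rooted-partition : ∀ b W S → countTrue n W < b → Partition W S
  rooted-partition (suc b) W S (s≤s W≤b) S⊆W S≥ S≤
    with countTrue n (W ∖ S) ≤? 18 * K * d | countTrue n S ≤? 12 * K
  ... | yes rest≤ | _ = two-parts G K d W S S⊆W 1≤d S≥ rest≤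
  ... | no rest≰ | yes small =
    expand W S (λ R → rooted-partition b (W ∖ S) R (ℕₚ.<-≤-trans smaller W≤b)) S⊆W (ℕₚ.≰⇒≥ rest≰) S≥ small
    where
    smaller : countTrue n (W ∖ S) < countTrue n W
    smaller = ℕₚ.<-≤-trans (ℕₚ.m<m+n _ (ℕₚ.<-≤-trans (s≤s z≤n) S≥))
      (count-disjoint (W ∖ S) S W (λ v → ∧-conicalˡ (W v) _) S⊆W (∖⇒∉ W S))
  ... | no _ | no large =
    divide sep S⊆W (ℕₚ.≰⇒≥ large) S≤
      (rooted-partition b _ _ (ℕₚ.<-≤-trans (left< sep S⊆W (ℕₚ.≰⇒≥ large)) W≤b))
      (rooted-partition b _ _ (ℕₚ.<-≤-trans (right< sep S⊆W (ℕₚ.≰⇒≥ large)) W≤b))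
    where
    sep : Separation G K S
    sep = balanced-separation D k bag-size S S≥

  -- From rooted partitions to the theorem

  TreePartition : Set
  TreePartition = Σ ℕ λ m → Σ (Graph m) λ T → IsTree T × (maxDegree T ≤ 6 * d) ×
    (Σ (Fin n → Fin m) λ f → IsTPartition G T f × (partitionWidth f ≤ 18 * K * d))

  -- Such a graph may be too small to contain a root set of 4K vertices, and it fits into a single
  -- part.
  one-part : n ≤ 4 * K → TreePartition
  one-part small = 1 , tree , isTree , maxDegree-bound z≤n (λ ()) ,
    (λ _ → zero) , (λ _ _ _ → inj₁ refl) ,
    maxOver-lub (partSize {n} {1} λ _ → zero) λ _ →
      ≤-trans (count-≤-size {n} _) (≤-trans small (four≤ 14 K 1≤d))
    where
    open ParentTree {0} (λ ()) (λ ())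

  -- Any set of exactly 4K vertices can start the induction; as `d` is positive, it also meets the
  -- upper limit 12Kd.
  many-parts : 4 * K ≤ n → TreePartition
  many-parts large with S , _ , _ , #S ← subset-of-size {n} (λ _ → false) (λ _ → true) (4 * K) (λ _ ())
      (≤-trans (≤-reflexive (count-false {n} _ λ _ → refl)) z≤n) (≤-trans large count-true)
    = suc size , tree , isTree ,
      maxDegree-bound (ℕₚ.<⇒≤ (children< P S≤ zero)) (λ i → children< P S≤ (suc i)) ,
      place , (λ v w e → separated (edges v w refl refl e)) , maxOver-lub (partSize place) (parts≤ P S≤)
    where
    S≤ : countTrue n S ≤ 12 * K * d
    S≤ = ≤-trans (≤-reflexive #S) (four≤ 8 K 1≤d)
    P : RootedPartition G K d (λ _ → true) S
    P = rooted-partition _ _ S ≤-refl (λ _ _ → refl) (≤-reflexive (≡-sym #S)) S≤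
    open RootedPartition P
    open ParentTree par par≤
    separated : ∀ {x y} → Near par x y → x ≡ y ⊎ adj tree x y ≡ true
    separated (inj₁ e) = inj₁ e
    separated {y = y} (inj₂ (inj₁ (i , refl , e))) = inj₂ (∨⁺ˡ (isYes⁺ (par i ≟ y) e))
    separated {x = x} (inj₂ (inj₂ (i , refl , e))) = inj₂ (∨⁺ʳ {childOf x (suc i)} (isYes⁺ (par i ≟ x) e))

  tree-partition : TreePartition
  tree-partition with ℕₚ.≤-total n (4 * K)
  ... | inj₁ small = one-part small
  ... | inj₂ large = many-parts large

theorem2 : ∀ {n} (G : Graph n) (k : ℕ) → IsTreewidth G k → NonTrivial G →
    Σ ℕ λ m → Σ (Graph m) λ T → IsTree T × (maxDegree T ≤ 6 * maxDegree G) ×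
    (Σ (Fin n → Fin m) λ f → IsTPartition G T f ×
    (partitionWidth f ≤ 18 * (k + 1) * maxDegree G))
theorem2 {n} G k ((D , width) , _) (x , y , xy) rewrite ℕₚ.+-comm k 1 =
  -- The given edge provides a vertex of positive degree, whence `1 ≤ d`.
  tree-partition D k bag-size (maxDegree G) (≤-trans (count-∃ (adj G x) y xy) (maxOver-ub (degree G) x))
    (maxOver-ub (degree G))
  where
  bag-size : ∀ t → countTrue n (TreeDecomposition.bag D t) ≤ suc k
  bag-size t = ≤-trans (maxOver-ub (λ t → countTrue n (TreeDecomposition.bag D t)) t)
    -- The width is a truncated difference, but the largest bag size is at most one more than it in
    -- every case.
    (≤-trans (ℕₚ.m≤n+m∸n _ 1) (s≤s (≤-reflexive width)))
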